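{- Let $G$ and $H$ be graphs with $\chi(G)<\chi(H)$. Then there exists a graph $F$ such that $F\rightarrow G$ and $F\not\rightarrow H$.
   Context: Graphs are finite and simple. $\chi(G)$ denotes the chromatic number of $G$, i.e. the minimum number of colours in a vertex colouring of $G$ in which no two adjacent vertices receive the same colour. For graphs $F$ and $G$, $F\rightarrow G$ ("$F$ is Ramsey for $G$") means that every colouring of the edges of $F$ in two colours contains a monochromatic copy of $G$, that is, a (not necessarily induced) subgraph of $F$ isomorphic to $G$ all of whose edges have the same colour. $F\not\rightarrow G$ means that $F$ is not Ramsey for $G$. -}

module Defs where

open import Level using (0ℓ)
open import Data.Nat.Base using (ℕ; zero; suc; _≤_; _^_; z≤n; s≤s)
open import Data.Fin.Base using (Fin; finToFun; funToFin)
open import Data.Fin.Properties using (_≟_; any?; all?; finToFun-funToFin)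
open import Data.Product.Base using (Σ-syntax; ∃-syntax; _×_; _,_; proj₁; proj₂)
open import Function.Base using (_∘_; id)
open import Function.Definitions using (Injective)
open import Relation.Binary.Core using (Rel)
open import Relation.Binary.Definitions using (Decidable; Symmetric; Irreflexive)
open import Relation.Binary.PropositionalEquality
  using (_≡_; _≢_; _≗_; refl; sym; trans)
open import Relation.Nullary using (¬_; Dec; yes; no; contradiction)
open import Relation.Nullary.Decidable using (map′; ¬?; _→-dec_)
open import Relation.Unary using (Pred) renaming (Decidable to Decidable₁)

record Graph : Set₁ where
  field
    order  : ℕ
  Vertex : Set
  Vertex = Fin order
  field
    Adj        : Rel Vertex 0ℓ
    adj?       : Decidable Adj
    adj-sym    : Symmetric Adj
    adj-irrefl : Irreflexive _≡_ Adj

open Graph public using (Vertex)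

module _ (G : Graph) where
  open Graph G using (order; Adj; adj?)

  IsProper : ∀ {k} → (Vertex G → Fin k) → Set
  IsProper f = ∀ u v → Adj u v → f u ≢ f v

  Colourable : ℕ → Set
  Colourable k = Σ[ f ∈ (Vertex G → Fin k) ] IsProper f

  IsChromaticNumber : ℕ → Set
  IsChromaticNumber k = Colourable k × (∀ j → Colourable j → k ≤ j)

  isProper? : ∀ {k} (f : Vertex G → Fin k) → Dec (IsProper f)
  isProper? f = all? λ u → all? λ v → adj? u v →-dec ¬? (f u ≟ f v)

  isProper-resp : ∀ {k} {f g : Vertex G → Fin k} → f ≗ g → IsProper f → IsProper g
  isProper-resp f≗g proper u v uv gu≡gv =
    proper u v uv (trans (f≗g u) (trans gu≡gv (sym (f≗g v))))

  -- Functions Fin order → Fin k are enumerated by Fin (k ^ order).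
  colourable? : Decidable₁ Colourable
  colourable? k = map′
    (λ (i , proper) → finToFun i , proper)
    (λ (f , proper) → funToFin f , isProper-resp (sym ∘ finToFun-funToFin f) proper)
    (any? {k ^ order} (λ i → isProper? (finToFun i)))

  colourable-order : Colourable order
  colourable-order = id , λ { u v uv refl → Graph.adj-irrefl G refl uv }

least : ∀ {P : Pred ℕ 0ℓ} → Decidable₁ P → ∀ n → P n →
        ∃[ k ] P k × (∀ j → P j → k ≤ j)
least P? n pn with P? zero
least P? n       pn | yes p0 = zero , p0 , λ _ _ → z≤n
least P? zero    pn | no ¬p0 = contradiction pn ¬p0
least P? (suc n) pn | no ¬p0 with least (P? ∘ suc) n pn
... | k , pk , k-min = suc k , pk , λ where
  zero    p0 → contradiction p0 ¬p0
  (suc j) pj → s≤s (k-min j pj)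

chromaticNumber : ∀ G → ∃[ k ] IsChromaticNumber G k
chromaticNumber G = least (colourable? G) (Graph.order G) (colourable-order G)

χ : Graph → ℕ
χ G = proj₁ (chromaticNumber G)

-- A colour for each unordered edge: by col-sym (and symmetry of Adj) the colour
-- depends neither on the orientation nor on the proof of adjacency.
record EdgeColouring (F : Graph) : Set where
  open Graph F using (Adj)
  field
    col     : ∀ {u v} → Adj u v → Fin 2
    col-sym : ∀ {u v} (e : Adj u v) (e′ : Adj v u) → col e ≡ col e′

-- The subgraph of F isomorphic to G is the image of G under the embedding; its
-- edges are exactly the images of the edges of G, so it need not be induced.
record Copy (G F : Graph) : Set where
  private
    module G = Graph G
    module F = Graph F
  field
    embed     : Vertex G → Vertex F
    injective : Injective _≡_ _≡_ embed
    edge      : ∀ {u v} → G.Adj u v → F.Adj (embed u) (embed v)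

IsMonochromatic : ∀ {G F} → EdgeColouring F → Copy G F → Set
IsMonochromatic {G} c copy =
  ∃[ a ] (∀ {u v} (e : Graph.Adj G u v) → EdgeColouring.col c (Copy.edge copy e) ≡ a)

infix 4 _⟶_ _↛_

_⟶_ : Graph → Graph → Set
F ⟶ G = (c : EdgeColouring F) → Σ[ copy ∈ Copy G F ] IsMonochromatic c copy

_↛_ : Graph → Graph → Set
F ↛ G = ¬ (F ⟶ G)

{-# OPTIONS --safe #-}

-- We build F ⟶ G all of whose subgraphs on at most |H| vertices are χ(G)-colourable, so that
-- F contains no copy of H. Local colourability is improved one vertex at a time by the partite
-- construction of Nešetřil and Rödl. Given C ⟶ G, start from disjoint copies of G projecting to
-- C and, for each pair of parts in turn, amalgamate copies of the current graph along the lines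
-- of a Hales–Jewett cube over the edges between the two parts, so that some copy has all these
-- edges of one colour. In the end some copy has its colours induced from a colouring of C.
-- Of s + 1 vertices in the result, either two lie in the same part, and colouring s vertices of
-- C is enough, or they are transversal. Transversals remain colourable in an amalgamation: one
-- has only two vertices shared between different copies, and the colourings of the copies can
-- be permuted to agree there.
module Submission where

open import Defs
open import Level using (0ℓ)
open import Data.Nat.Base using (ℕ; zero; suc; _+_; _*_; _^_; _≤_; _<_; s≤s)
import Data.Nat.Properties as ℕ
open import Data.Fin.Base as Fin using (Fin; zero; suc; combine; remQuot; funToFin; finToFun;
  punchIn; punchOut)
open import Data.Fin.Properties as Fin using (remQuot-combine; finToFun-funToFin;
  pigeonhole; any?; cast-involutive; punchIn-punchOut)
open import Data.Fin.Permutation.Components using (transpose; transpose-inverse)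
open import Data.Maybe.Base as Maybe using (Maybe; just; nothing; maybe′)
open import Data.Vec.Base as Vec using (Vec; []; _∷_; _++_)
import Data.Vec.Properties as Vec
open import Data.Vec.Relation.Unary.Any as Any using (here; there)
open import Data.Vec.Membership.Propositional using (_∈_)
open import Data.Vec.Membership.Propositional.Properties using (∈-++⁺ˡ; ∈-++⁺ʳ; ∈-map⁺)
open import Data.List.Base as List using (List; []; _∷_; length; filter; allFin)
open import Data.List.Properties using (length-tabulate)
open import Data.List.Membership.Propositional.Properties using (∈-lookup; ∈-filter⁺; ∈-allFin)
  renaming (∈-map⁺ to ∈ˡ-map⁺)
open import Data.List.Membership.Propositional using () renaming (_∈_ to _∈ˡ_)
open import Data.List.Relation.Unary.Any using (index) renaming (here to hereˡ; there to thereˡ)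
open import Data.List.Relation.Unary.Any.Properties using (lookup-index)
open import Data.List.Relation.Unary.All as All using ([]; _∷_)
import Data.List.Relation.Unary.All.Properties as All
open import Data.List.Relation.Unary.AllPairs using (AllPairs; []; _∷_)
open import Data.List.Relation.Unary.Unique.Propositional.Properties using (allFin⁺)
open import Data.List.Relation.Binary.Sublist.Propositional using (_⊆_; []; _∷_; _∷ʳ_; minimum; ⊆-trans)
open import Data.List.Relation.Binary.Sublist.Propositional.Properties using (All-resp-⊆; filter-⊆)
open import Data.Product.Base using (Σ-syntax; ∃-syntax; _×_; _,_; proj₁; proj₂)
open import Data.Sum.Base using (_⊎_; inj₁; inj₂)
open import Function.Base using (_∘_; id)
open import Function.Definitions using (Injective)
open import Relation.Binary.Core using (Rel)
open import Relation.Binary.Definitions using (Decidable; DecidableEquality; Symmetric)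
open import Relation.Binary.PropositionalEquality
  using (_≡_; _≢_; refl; sym; trans; cong; cong₂; subst; subst₂)
open import Relation.Nullary using (¬_; Dec; yes; no; contradiction)
open import Relation.Nullary.Decidable using (map′; ¬?; _×-dec_; dec-true; dec-false)
open import Relation.Unary using (Pred) renaming (Decidable to Decidable₁)

-- Finite types.

-- A retraction rather than a bijection: `from-to` makes `toFin` injective, which decides equality,
-- and `fromFin` surjective, which makes search exhaustive.
record Finite (A : Set) : Set where
  field
    size     : ℕ
    toFin    : A → Fin size
    fromFin  : Fin size → A
    from-to  : ∀ x → fromFin (toFin x) ≡ x

  infix 4 _≟_
  _≟_ : DecidableEquality A
  x ≟ y = map′ (λ eq → trans (sym (from-to x)) (trans (cong fromFin eq) (from-to y)))
               (cong toFin) (toFin x Fin.≟ toFin y)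

  search : {P : Pred A 0ℓ} → Decidable₁ P → Dec (∃[ x ] P x)
  search {P} P? = map′ (λ (i , p) → fromFin i , p)
                       (λ (x , p) → toFin x , subst P (sym (from-to x)) p)
                       (any? (P? ∘ fromFin))

open Finite using (size; toFin; fromFin; from-to)

Fin-finite : ∀ n → Finite (Fin n)
Fin-finite n = record { size = n ; toFin = id ; fromFin = id ; from-to = λ _ → refl }

×-finite : ∀ {A B} → Finite A → Finite B → Finite (A × B)
×-finite {A} {B} finA finB = record
  { size    = size finA * size finB
  ; toFin   = λ (a , b) → combine (toFin finA a) (toFin finB b)
  ; fromFin = λ i → decode (remQuot (size finB) i)
  ; from-to = λ (a , b) → trans (cong decode (remQuot-combine (toFin finA a) (toFin finB b)))
                                (cong₂ _,_ (from-to finA a) (from-to finB b))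
  }
  where
  decode : Fin (size finA) × Fin (size finB) → A × B
  decode (i , j) = fromFin finA i , fromFin finB j

Maybe-finite : ∀ {A} → Finite A → Finite (Maybe A)
Maybe-finite {A} finA = record
  { size    = suc (size finA)
  ; toFin   = maybe′ (suc ∘ toFin finA) zero
  ; fromFin = λ { zero → nothing ; (suc i) → just (fromFin finA i) }
  ; from-to = λ { nothing → refl ; (just a) → cong just (from-to finA a) }
  }

Vec-finite : ∀ {A} → Finite A → ∀ n → Finite (Vec A n)
Vec-finite finA zero = record
  { size = 1 ; toFin = λ _ → zero ; fromFin = λ _ → [] ; from-to = λ { [] → refl } }
Vec-finite {A} finA (suc n) = record
  { size    = size pairs
  ; toFin   = λ { (x ∷ xs) → toFin pairs (x , xs) }
  ; fromFin = cons ∘ fromFin pairs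
  ; from-to = λ { (x ∷ xs) → cong cons (from-to pairs (x , xs)) }
  }
  where
  pairs : Finite (A × Vec A n)
  pairs = ×-finite finA (Vec-finite finA n)
  cons : A × Vec A n → Vec A (suc n)
  cons (x , xs) = x ∷ xs

-- The Hales–Jewett theorem

-- `nothing` is the wildcard; a template containing it is a combinatorial line.
Template : Set → ℕ → Set
Template A d = Vec (Maybe A) d

eval : ∀ {A : Set} {d} → Template A d → A → Vec A d
eval t e = Vec.map (maybe′ id e) t

-- A combinatorial subspace in block form: each of the `n` coordinates moves along its own line in
-- its own block.
data Subspace (A : Set) : ℕ → ℕ → Set where
  []  : Subspace A 0 0
  add : ∀ {n N d} (ℓ : Template A N) → nothing ∈ ℓ → Subspace A n d → Subspace A (suc n) (N + d)

-- With `f = id` this gives points of the subspace; with `f = just` it turns a template inside the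
-- subspace into one of the whole cube.
substitute : ∀ {A B : Set} {n d} → (A → B) → Subspace A n d → Vec B n → Vec B d
substitute f []            []      = []
substitute f (add ℓ _ s) (b ∷ w) = Vec.map (maybe′ f b) ℓ ++ substitute f s w

eval-substitute : ∀ {A : Set} {n d} (s : Subspace A n d) (t : Template A n) e →
                  eval (substitute just s t) e ≡ substitute id s (eval t e)
eval-substitute []          []      e = refl
eval-substitute (add ℓ _ s) (b ∷ t) e = trans
  (Vec.map-++ (maybe′ id e) (Vec.map (maybe′ just b) ℓ) (substitute just s t))
  (cong₂ _++_
    (trans (sym (Vec.map-∘ (maybe′ id e) (maybe′ just b) ℓ))
           (Vec.map-cong (λ { nothing → refl ; (just _) → refl }) ℓ))
    (eval-substitute s t e))

substitute-active : ∀ {A : Set} {n d} (s : Subspace A n d) {t : Template A n} →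
                    nothing ∈ t → nothing ∈ substitute just s t
substitute-active (add ℓ ∗∈ℓ s) (here refl) = ∈-++⁺ˡ (∈-map⁺ (maybe′ just nothing) ∗∈ℓ)
substitute-active (add ℓ ∗∈ℓ s) {b ∷ t} (there ∗∈t) =
  ∈-++⁺ʳ (Vec.map (maybe′ just b) ℓ) (substitute-active s ∗∈t)

module _ {A : Set} (x y : A) where

  -- The word of `i` letters `y` followed by letters `x` only.
  threshold : ∀ {N} → Fin (suc N) → Vec A N
  threshold {zero}  _       = []
  threshold {suc N} zero    = x ∷ threshold {N} zero
  threshold {suc N} (suc i) = y ∷ threshold i

  -- The two words differ on one interval, where the first has only `x` and the second only `y`; the
  -- wildcards go there.
  thresholdLine : ∀ {N} {i j : Fin (suc N)} → i Fin.< j →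
                  Σ[ ℓ ∈ Template A N ] nothing ∈ ℓ × eval ℓ x ≡ threshold i × eval ℓ y ≡ threshold j
  thresholdLine {suc N} {zero} {suc j} _ =
    nothing ∷ tail j , here refl , cong (x ∷_) (tail-x j) , cong (y ∷_) (tail-y j)
    where
    tail : ∀ {N} → Fin (suc N) → Template A N
    tail {zero}  _       = []
    tail {suc N} zero    = just x ∷ tail {N} zero
    tail {suc N} (suc j) = nothing ∷ tail j
    tail-x : ∀ {N} (j : Fin (suc N)) → eval (tail j) x ≡ threshold zero
    tail-x {zero}  _       = refl
    tail-x {suc N} zero    = cong (x ∷_) (tail-x {N} zero)
    tail-x {suc N} (suc j) = cong (x ∷_) (tail-x j)
    tail-y : ∀ {N} (j : Fin (suc N)) → eval (tail j) y ≡ threshold j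
    tail-y {zero}  _       = refl
    tail-y {suc N} zero    = cong (x ∷_) (tail-y {N} zero)
    tail-y {suc N} (suc j) = cong (y ∷_) (tail-y j)
  thresholdLine {suc N} {suc i} {suc j} (s≤s i<j) with thresholdLine i<j
  ... | ℓ , ∗∈ℓ , ℓx , ℓy = just y ∷ ℓ , there ∗∈ℓ , cong (y ∷_) ℓx , cong (y ∷_) ℓy

funToFin-injective : ∀ {m n} {f g : Fin m → Fin n} → funToFin f ≡ funToFin g → ∀ i → f i ≡ g i
funToFin-injective {f = f} {g} eq i =
  trans (sym (finToFun-funToFin f i)) (trans (cong (λ c → finToFun c i) eq) (finToFun-funToFin g i))

-- Each block carries more threshold words than there are colourings of the
-- remaining blocks, so the colouring does not distinguish two of them.
insensitive : ∀ {m} (x y : Fin m) n k → ∃[ d ] ((χ : Vec (Fin m) d → Fin k) →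
  Σ[ s ∈ Subspace (Fin m) n d ] ((t : Template (Fin m) n) →
    χ (substitute id s (eval t x)) ≡ χ (substitute id s (eval t y))))
insensitive x y zero    k = 0 , λ χ → [] , λ { [] → refl }
-- A word on the later blocks is coloured by the list of colours it gets as the first block runs
-- through the `m` points of its line, hence `k ^ m` colours.
insensitive {m} x y (suc n) k with insensitive x y n (k ^ m)
... | d , rest = N + d , go
  where
  words : Finite (Vec (Fin m) d)
  words = Vec-finite (Fin-finite m) d
  N : ℕ
  N = k ^ size words
  go : (χ : Vec (Fin m) (N + d) → Fin k) → Σ[ s ∈ Subspace (Fin m) (suc n) (N + d) ]
       ((t : Template (Fin m) (suc n)) →
         χ (substitute id s (eval t x)) ≡ χ (substitute id s (eval t y)))
  go χ with pigeonhole (ℕ.n<1+n N) (λ u → funToFin (λ i → χ (threshold x y u ++ fromFin words i)))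
  ... | i , j , i<j , same with thresholdLine x y i<j
  ... | ℓ , ∗∈ℓ , ℓx , ℓy with rest (λ w → funToFin (λ a → χ (eval ℓ a ++ w)))
  ... | s , inv = add ℓ ∗∈ℓ s , λ where
      (just a  ∷ t) → swapRest a t
      (nothing ∷ t) → trans (swapBlock (substitute id s (eval t x))) (swapRest y t)
    where
    swapBlock : ∀ w → χ (eval ℓ x ++ w) ≡ χ (eval ℓ y ++ w)
    swapBlock w = subst₂ (λ u v → χ (u ++ w) ≡ χ (v ++ w)) (sym ℓx) (sym ℓy)
      (subst (λ w → χ (threshold x y i ++ w) ≡ χ (threshold x y j ++ w)) (from-to words w)
        (funToFin-injective same (toFin words w)))
    swapRest : ∀ a t → χ (eval ℓ a ++ substitute id s (eval t x)) ≡ χ (eval ℓ a ++ substitute id s (eval t y))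
    swapRest a t = funToFin-injective (inv t) a

-- Shelah's argument: on a subspace insensitive to exchanging the letters 0 and 1,
-- a line that is monochromatic without the letter 0 is monochromatic.
hales-jewett : ∀ m k → ∃[ d ] ((χ : Vec (Fin m) d → Fin (suc k)) →
  Σ[ t ∈ Template (Fin m) d ] nothing ∈ t × ∃[ a ] (∀ e → χ (eval t e) ≡ a))
-- Over the empty alphabet only a wildcard and some colour are required.
hales-jewett zero    k = 1 , λ χ → nothing ∷ [] , here refl , zero , λ ()
hales-jewett (suc zero) k = 1 , λ χ →
  nothing ∷ [] , here refl , χ (zero ∷ []) , λ { zero → refl }
hales-jewett (suc (suc m)) k with hales-jewett (suc m) k
... | n , line with insensitive {suc (suc m)} zero (suc zero) n (suc k)
... | d , subspace = d , go
  where
  go : (χ : Vec (Fin (suc (suc m))) d → Fin (suc k)) →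
       Σ[ t ∈ Template (Fin (suc (suc m))) d ] nothing ∈ t × ∃[ a ] (∀ e → χ (eval t e) ≡ a)
  go χ with subspace χ
  ... | s , inv with line (χ ∘ substitute id s ∘ Vec.map suc)
  ... | t , ∗∈t , a , mono = substitute just s t⁺ , substitute-active s (∈-map⁺ (Maybe.map suc) ∗∈t) , a , mono⁺
    where
    t⁺ : Template (Fin (suc (suc m))) n
    t⁺ = Vec.map (Maybe.map suc) t
    eval-suc : ∀ e → eval t⁺ (suc e) ≡ Vec.map suc (eval t e)
    eval-suc e = trans (sym (Vec.map-∘ (maybe′ id (suc e)) (Maybe.map suc) t))
      (trans (Vec.map-cong (λ { nothing → refl ; (just _) → refl }) t) (Vec.map-∘ suc (maybe′ id e) t))
    monoSuc : ∀ e → χ (substitute id s (eval t⁺ (suc e))) ≡ a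
    monoSuc e = trans (cong (χ ∘ substitute id s) (eval-suc e)) (mono e)
    mono⁺ : ∀ e → χ (eval (substitute just s t⁺) e) ≡ a
    mono⁺ zero    = trans (cong χ (eval-substitute s t⁺ zero)) (trans (inv t⁺) (monoSuc zero))
    mono⁺ (suc e) = trans (cong χ (eval-substitute s t⁺ (suc e))) (monoSuc e)

-- Ramsey's theorem

-- The Erdős-Szekeres recursion, splitting the tail of the list by its colour to the head. Sublists
-- play the role of vertex subsets.
ramsey : ∀ a b → ∃[ N ] (∀ {V : Set} (c : V → V → Fin 2) (xs : List V) → N ≤ length xs →
  (Σ[ ys ∈ List V ] ys ⊆ xs × length ys ≡ a × AllPairs (λ x y → c x y ≡ zero) ys) ⊎
  (Σ[ ys ∈ List V ] ys ⊆ xs × length ys ≡ b × AllPairs (λ x y → c x y ≡ suc zero) ys))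
ramsey zero    b       = 0 , λ c xs _ → inj₁ ([] , minimum xs , refl , [])
ramsey (suc a) zero    = 0 , λ c xs _ → inj₂ ([] , minimum xs , refl , [])
ramsey (suc a) (suc b) with ramsey a (suc b) | ramsey (suc a) b
... | M , left | N , right = suc (M + N) , go
  where
  go : ∀ {V : Set} (c : V → V → Fin 2) (xs : List V) → suc (M + N) ≤ length xs →
    (Σ[ ys ∈ List V ] ys ⊆ xs × length ys ≡ suc a × AllPairs (λ x y → c x y ≡ zero) ys) ⊎
    (Σ[ ys ∈ List V ] ys ⊆ xs × length ys ≡ suc b × AllPairs (λ x y → c x y ≡ suc zero) ys)
  go c (x ∷ xs) (s≤s long) = branch (M ℕ.≤? length zeros)
    where
    zero? : Decidable₁ (λ y → c x y ≡ zero)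
    zero? y = c x y Fin.≟ zero
    one? : Decidable₁ (λ y → ¬ (c x y ≡ zero))
    one? y = ¬? (zero? y)
    zeros ones : List _
    zeros = filter zero? xs
    ones  = filter one? xs
    split : ∀ zs → length zs ≡ length (filter zero? zs) + length (filter one? zs)
    split [] = refl
    split (z ∷ zs) with zero? z
    ... | yes _ = cong suc (split zs)
    ... | no  _ = trans (cong suc (split zs)) (sym (ℕ.+-suc _ _))
    nonzero : ∀ (i : Fin 2) → ¬ (i ≡ zero) → i ≡ suc zero
    nonzero zero       i≢0 = contradiction refl i≢0
    nonzero (suc zero) _   = refl
    branch : Dec (M ≤ length zeros) →
      (Σ[ ys ∈ List _ ] ys ⊆ x ∷ xs × length ys ≡ suc a × AllPairs (λ x y → c x y ≡ zero) ys) ⊎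
      (Σ[ ys ∈ List _ ] ys ⊆ x ∷ xs × length ys ≡ suc b × AllPairs (λ x y → c x y ≡ suc zero) ys)
    branch (yes M≤) with left c zeros M≤
    ... | inj₁ (ys , ys⊆ , len , mono) = inj₁ (x ∷ ys , refl ∷ ⊆-trans ys⊆ (filter-⊆ zero? xs) ,
            cong suc len , All-resp-⊆ ys⊆ (All.all-filter zero? xs) ∷ mono)
    ... | inj₂ (ys , ys⊆ , len , mono) = inj₂ (ys , x ∷ʳ ⊆-trans ys⊆ (filter-⊆ zero? xs) , len , mono)
    -- Since `zeros` and `ones` together have at least `M + N` entries, few zeros leave at least `N`
    -- ones.
    branch (no M≰) with right c ones (ℕ.+-cancelˡ-≤ M _ _ (ℕ.≤-trans long
      (ℕ.≤-trans (ℕ.≤-reflexive (split xs)) (ℕ.+-monoˡ-≤ _ (ℕ.≰⇒≥ M≰)))))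
    ... | inj₁ (ys , ys⊆ , len , mono) = inj₁ (ys , x ∷ʳ ⊆-trans ys⊆ (filter-⊆ one? xs) , len , mono)
    ... | inj₂ (ys , ys⊆ , len , mono) = inj₂ (x ∷ ys , refl ∷ ⊆-trans ys⊆ (filter-⊆ one? xs) ,
            cong suc len , All.map (nonzero _) (All-resp-⊆ ys⊆ (All.all-filter one? xs)) ∷ mono)

AllPairs-resp-⊆ : ∀ {A : Set} {R : Rel A 0ℓ} {xs ys} → xs ⊆ ys → AllPairs R ys → AllPairs R xs
AllPairs-resp-⊆ []            []          = []
AllPairs-resp-⊆ (_    ∷ʳ sub) (_  ∷ prs)  = AllPairs-resp-⊆ sub prs
AllPairs-resp-⊆ (refl ∷  sub) (px ∷ prs)  = All-resp-⊆ sub px ∷ AllPairs-resp-⊆ sub prs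

AllPairs-lookup : ∀ {A : Set} {R : Rel A 0ℓ} → Symmetric R → ∀ {xs} → AllPairs R xs →
                  ∀ {i j} → i ≢ j → R (List.lookup xs i) (List.lookup xs j)
AllPairs-lookup symR (px ∷ prs) {zero}  {zero}  i≢j = contradiction refl i≢j
AllPairs-lookup symR (px ∷ prs) {zero}  {suc j} _   = All.lookup px (∈-lookup j)
AllPairs-lookup symR (px ∷ prs) {suc i} {zero}  _   = symR (All.lookup px (∈-lookup i))
AllPairs-lookup symR (px ∷ prs) {suc i} {suc j} i≢j = AllPairs-lookup symR prs (i≢j ∘ cong suc)

-- Graphs on an arbitrary finite vertex set

record FiniteGraph : Set₁ where
  field
    V          : Set
    finite     : Finite V
    Adj        : Rel V 0ℓ
    adj?       : Decidable Adj
    adj-sym    : Symmetric Adj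
    adj-irrefl : ∀ {v} → ¬ Adj v v

open FiniteGraph using (V)

record Embedding (P Q : FiniteGraph) : Set where
  field
    embed     : V P → V Q
    injective : Injective _≡_ _≡_ embed
    edge      : ∀ {u v} → FiniteGraph.Adj P u v → FiniteGraph.Adj Q (embed u) (embed v)

open Embedding using (embed)

-- All pairs are coloured, not only edges, so a colouring pulls back along any map of vertices.
SymColouring : Set → Set
SymColouring A = Σ[ c ∈ (A → A → Fin 2) ] (∀ u v → c u v ≡ c v u)

Arrows : FiniteGraph → FiniteGraph → Set
Arrows C G = ((c , _) : SymColouring (V C)) → Σ[ f ∈ Embedding G C ] ∃[ a ]
  (∀ {u v} → FiniteGraph.Adj G u v → c (embed f u) (embed f v) ≡ a)

-- `g` may repeat vertices and the indices are what is coloured, so the property can be applied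
-- after a projection that identifies vertices.
Local : ℕ → ℕ → FiniteGraph → Set
Local k s C = (g : Fin s → V C) →
  Σ[ φ ∈ (Fin s → Fin k) ] (∀ i j → FiniteGraph.Adj C (g i) (g j) → φ i ≢ φ j)

complete : ℕ → FiniteGraph
complete N = record
  { V = Fin N ; finite = Fin-finite N ; Adj = _≢_ ; adj? = λ i j → ¬? (i Fin.≟ j)
  ; adj-sym = λ i≢j → i≢j ∘ sym ; adj-irrefl = λ i≢i → i≢i refl }

finiteGraph : Graph → FiniteGraph
finiteGraph G = record
  { V = Vertex G ; finite = Fin-finite (Graph.order G) ; Adj = Graph.Adj G ; adj? = Graph.adj? G
  ; adj-sym = Graph.adj-sym G ; adj-irrefl = Graph.adj-irrefl G refl }

-- Base of the induction: a monochromatic clique on as many vertices as `G` contains `G`.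
complete-arrows : ∀ (G : Graph) → ∃[ N ] Arrows (complete N) (finiteGraph G)
complete-arrows G with ramsey (Graph.order G) (Graph.order G)
... | N , clique = N , go
  where
  clique⇒copy : ((c , _) : SymColouring (Fin N)) (a : Fin 2) (ys : List (Fin N)) → ys ⊆ allFin N →
    length ys ≡ Graph.order G → AllPairs (λ x y → c x y ≡ a) ys →
    Σ[ f ∈ Embedding (finiteGraph G) (complete N) ] ∃[ a ]
      (∀ {u v} → Graph.Adj G u v → c (embed f u) (embed f v) ≡ a)
  clique⇒copy (c , c-sym) a ys sub len mono = record
      { embed = f ; injective = f-injective ; edge = λ uv fu≡fv → distinct uv (f-injective fu≡fv) } ,
      a , λ uv → AllPairs-lookup (λ {x} {y} cxy → trans (c-sym y x) cxy) mono (distinct uv ∘ cast-injective)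
    where
    cast-injective : ∀ {i j} → Fin.cast (sym len) i ≡ Fin.cast (sym len) j → i ≡ j
    cast-injective {i} {j} eq = trans (sym (cast-involutive len (sym len) i))
      (trans (cong (Fin.cast len) eq) (cast-involutive len (sym len) j))
    f : Vertex G → Fin N
    f u = List.lookup ys (Fin.cast (sym len) u)
    distinct : ∀ {u v} → Graph.Adj G u v → u ≢ v
    distinct uv refl = Graph.adj-irrefl G refl uv
    f-injective : Injective _≡_ _≡_ f
    f-injective {u} {v} fu≡fv with u Fin.≟ v
    ... | yes u≡v = u≡v
    ... | no  u≢v = contradiction fu≡fv (AllPairs-lookup {R = _≢_} (λ x≢y → x≢y ∘ sym)
            (AllPairs-resp-⊆ sub (allFin⁺ N)) (u≢v ∘ cast-injective))
  go : Arrows (complete N) (finiteGraph G)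
  go (c , c-sym) with clique c (allFin N) (ℕ.≤-reflexive (sym (length-tabulate id)))
  ... | inj₁ (ys , sub , len , mono) = clique⇒copy (c , c-sym) zero ys sub len mono
  ... | inj₂ (ys , sub , len , mono) = clique⇒copy (c , c-sym) (suc zero) ys sub len mono

-- The partite construction

elements : ∀ {A : Set} → Finite A → List A
elements finA = List.map (fromFin finA) (allFin (size finA))

∈-elements : ∀ {A : Set} (finA : Finite A) x → x ∈ˡ elements finA
∈-elements finA x = subst (_∈ˡ elements finA) (from-to finA x)
  (∈ˡ-map⁺ (fromFin finA) (∈-allFin (toFin finA x)))

enumerate : ∀ {A : Set} {P : Pred A 0ℓ} → Finite A → Decidable₁ P →
            ∃[ m ] Σ[ f ∈ (Fin m → A) ] (∀ i → P (f i)) × (∀ x → P x → ∃[ i ] f i ≡ x)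
enumerate {A} {P} finA P? =
  length found , List.lookup found ,
  (λ i → All.lookup (All.all-filter P? (elements finA)) (∈-lookup i)) ,
  λ x px → index (∈found x px) , sym (lookup-index (∈found x px))
  where
  found : List A
  found = filter P? (elements finA)
  ∈found : ∀ x → P x → x ∈ˡ found
  ∈found x px = ∈-filter⁺ P? (∈-elements finA x) px

transpose-left : ∀ {k} (i j : Fin k) → transpose i j i ≡ j
transpose-left i j rewrite dec-true (i Fin.≟ i) refl = refl

transpose-fixed : ∀ {k} {i j l : Fin k} → l ≢ i → l ≢ j → transpose i j l ≡ l
transpose-fixed {i = i} {j} {l} l≢i l≢j
  rewrite dec-false (l Fin.≟ i) l≢i | dec-false (l Fin.≟ j) l≢j = refl

transpose-injective : ∀ {k} (i j : Fin k) → Injective _≡_ _≡_ (transpose i j)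
transpose-injective i j eq =
  trans (sym (transpose-inverse j i)) (trans (cong (transpose j i) eq) (transpose-inverse j i))

-- Move `i` to `j` first, then the image of `i′` to `j′`; the second transposition fixes `j`.
recolourTwo : ∀ {k} {i i′ j j′ : Fin k} → i ≢ i′ → j ≢ j′ →
              Σ[ f ∈ (Fin k → Fin k) ] Injective _≡_ _≡_ f × f i ≡ j × f i′ ≡ j′
recolourTwo {i = i} {i′} {j} {j′} i≢i′ j≢j′ =
  transpose l j′ ∘ transpose i j ,
  transpose-injective i j ∘ transpose-injective l j′ ,
  trans (cong (transpose l j′) (transpose-left i j)) (transpose-fixed j≢l j≢j′) ,
  transpose-left l j′
  where
  l : Fin _
  l = transpose i j i′
  j≢l : j ≢ l
  j≢l j≡l = i≢i′ (transpose-injective i j (trans (transpose-left i j) j≡l))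

-- A `C`-partite graph: the parts are the fibres of `π`.
record System (C : FiniteGraph) : Set₁ where
  field
    graph : FiniteGraph
    π     : V graph → V C
    hom   : ∀ {u v} → FiniteGraph.Adj graph u v → FiniteGraph.Adj C (π u) (π v)

-- σ picks at most one vertex from each part: σ a counts only if it lies in part a.
Transversal : ℕ → (C : FiniteGraph) → System C → Set
Transversal k C P = (σ : V C → V graph) → Σ[ φ ∈ (V C → Fin k) ]
  (∀ {a b} → π (σ a) ≡ a → π (σ b) ≡ b → FiniteGraph.Adj graph (σ a) (σ b) → φ a ≢ φ b)
  where open System P

-- Amalgamation along a Hales-Jewett cube.

module Amalgam (C : FiniteGraph) (P : System C) (α β : V C) where

  private
    module C = FiniteGraph C
    module P = FiniteGraph (System.graph P)
  open System P using (π; hom)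
  open Finite C.finite using () renaming (_≟_ to _≟ᶜ_)
  open Finite P.finite using () renaming (_≟_ to _≟ᵖ_)

  IsEdge : P.V × P.V → Set
  IsEdge (x , y) = π x ≡ α × π y ≡ β × P.Adj x y

  isEdge? : Decidable₁ IsEdge
  isEdge? (x , y) = π x ≟ᶜ α ×-dec π y ≟ᶜ β ×-dec P.adj? x y

  abstract
    edges : ∃[ m ] Σ[ f ∈ (Fin m → P.V × P.V) ] (∀ i → IsEdge (f i)) × (∀ xy → IsEdge xy → ∃[ i ] f i ≡ xy)
    edges = enumerate (×-finite P.finite P.finite) isEdge?

  E : Set
  E = Fin (proj₁ edges)

  src tgt : E → P.V
  src e = proj₁ (proj₁ (proj₂ edges) e)
  tgt e = proj₂ (proj₁ (proj₂ edges) e)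

  isEdge : ∀ e → IsEdge (src e , tgt e)
  isEdge = proj₁ (proj₂ (proj₂ edges))

  src-tgt-adj : ∀ e → P.Adj (src e) (tgt e)
  src-tgt-adj e = proj₂ (proj₂ (isEdge e))

  E⇒α≢β : E → α ≢ β
  E⇒α≢β e α≡β = C.adj-irrefl (subst₂ C.Adj (trans (proj₁ (isEdge e)) α≡β)
    (proj₁ (proj₂ (isEdge e))) (hom (src-tgt-adj e)))

  abstract
    -- The dimension is put in successor form so that every word has a head, from which default
    -- vertices are read.
    line : ∃[ d ] ((χ : Vec E (suc d) → Fin 2) →
           Σ[ t ∈ Template E (suc d) ] nothing ∈ t × ∃[ a ] (∀ e → χ (eval t e) ≡ a))
    line = positive (hales-jewett (proj₁ edges) 1)
      where
      positive : (∃[ d ] ((χ : Vec E d → Fin 2) →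
                   Σ[ t ∈ Template E d ] nothing ∈ t × ∃[ a ] (∀ e → χ (eval t e) ≡ a))) →
                 ∃[ d ] ((χ : Vec E (suc d) → Fin 2) →
                   Σ[ t ∈ Template E (suc d) ] nothing ∈ t × ∃[ a ] (∀ e → χ (eval t e) ≡ a))
      positive (suc d , hj) = d , hj
      positive (zero  , hj) with hj (λ _ → zero)
      ... | [] , () , _

  D : ℕ
  D = suc (proj₁ line)

  Word : ℕ → Set
  Word n = Vec (Maybe E × P.V) n

  -- A coordinate of a copied vertex in part c: outside the parts α and β it
  -- records the line of the copy, inside them only the endpoint of the edge.
  code : V C → Maybe E → P.V → Maybe E × P.V
  code c m v with c ≟ᶜ α | c ≟ᶜ β
  ... | yes _ | _     = nothing , maybe′ src v m
  ... | no _  | yes _ = nothing , maybe′ tgt v m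
  ... | no _  | no _  = m , v

  code-nothing : ∀ c v → code c nothing v ≡ (nothing , v)
  code-nothing c v with c ≟ᶜ α | c ≟ᶜ β
  ... | yes _ | _     = refl
  ... | no _  | yes _ = refl
  ... | no _  | no _  = refl

  code-src : ∀ e v → code α (just e) v ≡ (nothing , src e)
  code-src e v with α ≟ᶜ α | α ≟ᶜ β
  ... | yes _  | _ = refl
  ... | no α≢α | _ = contradiction refl α≢α

  code-tgt : ∀ e v → code β (just e) v ≡ (nothing , tgt e)
  code-tgt e v with β ≟ᶜ α | β ≟ᶜ β
  -- `code` tests `α` first, so this case needs coinciding parts, which the edge `e` excludes.
  ... | yes β≡α | _      = contradiction (sym β≡α) (E⇒α≢β e)
  ... | no _    | yes _  = refl
  ... | no _    | no β≢β = contradiction refl β≢β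

  code-other : ∀ {c} → c ≢ α → c ≢ β → ∀ m v → code c m v ≡ (m , v)
  code-other {c} c≢α c≢β m v with c ≟ᶜ α | c ≟ᶜ β
  ... | yes c≡α | _       = contradiction c≡α c≢α
  ... | no _    | yes c≡β = contradiction c≡β c≢β
  ... | no _    | no _    = refl

  codes : ∀ {n} → V C → Template E n → P.V → Word n
  codes c t v = Vec.map (λ m → code c m v) t

  -- Each part holds all words; those met by no copy are isolated vertices.
  V′ : Set
  V′ = V C × Word D

  ι : Template E D → P.V → V′
  ι t v = π v , codes (π v) t v

  -- Wildcard coordinates carry the copied vertex itself, so the first one inverts the copy. The
  -- argument `v` is a default for templates without wildcard.
  locate : ∀ {n} → P.V → Template E n → Word n → P.V
  locate v []            []       = v
  locate v (nothing ∷ t) (x ∷ xs) = proj₂ x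
  locate v (just _  ∷ t) (x ∷ xs) = locate v t xs

  loc : Template E D → V′ → P.V
  loc t (_ , xs) = locate (proj₂ (Vec.head xs)) t xs

  loc-ι : ∀ {t} → nothing ∈ t → ∀ v → loc t (ι t v) ≡ v
  loc-ι ∗∈t v = go _ ∗∈t
    where
    go : ∀ {n} u {t : Template E n} → nothing ∈ t → locate u t (codes (π v) t v) ≡ v
    go u {nothing ∷ t} _           = cong proj₂ (code-nothing (π v) v)
    go u {just _  ∷ t} (there ∗∈t) = go u ∗∈t

  -- Two copies sharing a vertex of part α and a vertex of part β: where the first
  -- line is active, the second is active as well or its fixed letter is the pair.
  sharedPair : ∀ {n} {t t′ : Template E n} {x x′ y y′} → nothing ∈ t →
            codes α t x ≡ codes α t′ x′ → codes β t y ≡ codes β t′ y′ →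
            (x ≡ x′ × y ≡ y′) ⊎ P.Adj x y
  sharedPair {t = nothing ∷ _} {nothing ∷ _} {x} {x′} {y} {y′} _ eqα eqβ = inj₁
    ( cong proj₂ (trans (sym (code-nothing α x)) (trans (Vec.∷-injectiveˡ eqα) (code-nothing α x′)))
    , cong proj₂ (trans (sym (code-nothing β y)) (trans (Vec.∷-injectiveˡ eqβ) (code-nothing β y′))) )
  sharedPair {t = nothing ∷ _} {just e ∷ _} {x} {x′} {y} {y′} _ eqα eqβ = inj₂ (subst₂ P.Adj
    (cong proj₂ (trans (sym (code-src e x′)) (trans (sym (Vec.∷-injectiveˡ eqα)) (code-nothing α x))))
    (cong proj₂ (trans (sym (code-tgt e y′)) (trans (sym (Vec.∷-injectiveˡ eqβ)) (code-nothing β y))))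
    (src-tgt-adj e))
  sharedPair {t = just _ ∷ _} {_ ∷ _} (there ∗∈t) eqα eqβ =
    sharedPair ∗∈t (Vec.∷-injectiveʳ eqα) (Vec.∷-injectiveʳ eqβ)

  -- Outside the parts `α` and `β` a vertex determines its line, so different copies are disjoint
  -- there.
  codes-template : ∀ {c} → c ≢ α → c ≢ β → ∀ {n} (t : Template E n) v → Vec.map proj₁ (codes c t v) ≡ t
  codes-template c≢α c≢β []      v = refl
  codes-template c≢α c≢β (m ∷ t) v =
    cong₂ _∷_ (cong proj₁ (code-other c≢α c≢β m v)) (codes-template c≢α c≢β t v)

  Active : Template E D → Set
  Active t = nothing ∈ t

  active? : Decidable₁ Active
  active? = Any.any? λ { nothing → yes refl ; (just _) → no λ () }

  V′-finite : Finite V′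
  V′-finite = ×-finite C.finite (Vec-finite (×-finite (Maybe-finite (Fin-finite _)) P.finite) D)

  template-finite : Finite (Template E D)
  template-finite = Vec-finite (Maybe-finite (Fin-finite _)) D

  open Finite V′-finite using () renaming (_≟_ to _≟′_)

  Adj′ : Rel V′ 0ℓ
  Adj′ u v = Σ[ t ∈ Template E D ] Active t × ∃[ p ] ∃[ q ] (u ≡ ι t p × v ≡ ι t q × P.Adj p q)

  adj′? : Decidable Adj′
  adj′? u v = Finite.search template-finite λ t → active? t ×-dec
    (Finite.search P.finite λ p → Finite.search P.finite λ q →
      u ≟′ ι t p ×-dec v ≟′ ι t q ×-dec P.adj? p q)

  amalgam : System C
  amalgam = record
    { graph = record
      { V = V′ ; finite = V′-finite ; Adj = Adj′ ; adj? = adj′?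
      ; adj-sym = λ (t , ∗∈t , p , q , u≡ , v≡ , pq) → t , ∗∈t , q , p , v≡ , u≡ , P.adj-sym pq
      ; adj-irrefl = λ (t , ∗∈t , p , q , v≡p , v≡q , pq) → P.adj-irrefl
          (subst (P.Adj p) (trans (sym (loc-ι ∗∈t q)) (trans (cong (loc t) (trans (sym v≡q) v≡p)) (loc-ι ∗∈t p))) pq)
      }
    ; π   = proj₁
    ; hom = λ (t , _ , p , q , u≡ , v≡ , pq) →
        subst₂ C.Adj (cong proj₁ (sym u≡)) (cong proj₁ (sym v≡)) (hom pq)
    }

  copy : ∀ {t} → Active t → Embedding (System.graph P) (System.graph amalgam)
  copy {t} ∗∈t = record
    { embed     = ι t
    ; injective = λ {u} {v} eq → trans (sym (loc-ι ∗∈t u)) (trans (cong (loc t) eq) (loc-ι ∗∈t v))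
    ; edge      = λ {u} {v} uv → t , ∗∈t , u , v , refl , refl , uv
    }

  -- A word of edges is coloured by the pair formed by its word of sources and its word of targets.
  -- Evaluating a line at `e` then gives the image of `e` in the copy of that line.
  homogeneousCopy : (c : V′ → V′ → Fin 2) → Σ[ t ∈ Template E D ] Active t ×
    ∃[ a ] (∀ {x y} → π x ≡ α → π y ≡ β → P.Adj x y → c (ι t x) (ι t y) ≡ a)
  homogeneousCopy c with proj₂ line (λ es →
    c (α , Vec.map (λ e → nothing , src e) es) (β , Vec.map (λ e → nothing , tgt e) es))
  ... | t , ∗∈t , a , mono = t , ∗∈t , a , λ {x} {y} πx πy xy →
    onEdge (proj₂ (proj₂ (proj₂ edges)) (x , y) (πx , πy , xy))
    where
    src-word : ∀ e {n} (t : Template E n) → Vec.map (λ e → nothing , src e) (eval t e) ≡ codes α t (src e)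
    src-word e []            = refl
    src-word e (nothing ∷ t) = cong₂ _∷_ (sym (code-nothing α (src e))) (src-word e t)
    src-word e (just f  ∷ t) = cong₂ _∷_ (sym (code-src f (src e))) (src-word e t)
    tgt-word : ∀ e {n} (t : Template E n) → Vec.map (λ e → nothing , tgt e) (eval t e) ≡ codes β t (tgt e)
    tgt-word e []            = refl
    tgt-word e (nothing ∷ t) = cong₂ _∷_ (sym (code-nothing β (tgt e))) (tgt-word e t)
    tgt-word e (just f  ∷ t) = cong₂ _∷_ (sym (code-tgt f (tgt e))) (tgt-word e t)
    onEdge : ∀ {x y} → ∃[ e ] (src e , tgt e) ≡ (x , y) → c (ι t x) (ι t y) ≡ a
    onEdge (e , refl) = trans (cong₂ c
      (trans (cong (λ a → a , codes a t (src e)) (proj₁ (isEdge e))) (cong (α ,_) (sym (src-word e t))))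
      (trans (cong (λ b → b , codes b t (tgt e)) (proj₁ (proj₂ (isEdge e)))) (cong (β ,_) (sym (tgt-word e t)))))
      (mono e)

  -- Colouring transversals of the amalgam.

  module _ (k : ℕ) (transversal : Transversal k C P) (σ : V C → V′) where

    at : Template E D → V C → P.V
    at t a = loc t (σ a)

    -- Membership in a copy is tested by decoding and encoding again, which keeps it decidable.
    Inside : Template E D → V C → Set
    Inside t a = Active t × σ a ≡ ι t (at t a) × proj₁ (σ a) ≡ a

    inside? : ∀ t → Decidable₁ (Inside t)
    inside? t a = active? t ×-dec σ a ≟′ ι t (at t a) ×-dec proj₁ (σ a) ≟ᶜ a

    inside-π : ∀ {t a} → Inside t a → π (at t a) ≡ a
    inside-π (_ , eq , part) = trans (sym (cong proj₁ eq)) part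

    inside-codes : ∀ {t a} → Inside t a → proj₂ (σ a) ≡ codes a t (at t a)
    inside-codes {t} {a} ins@(_ , eq , _) =
      trans (cong proj₂ eq) (cong (λ c → codes c t (at t a)) (inside-π {t} ins))

    template : V C → Template E D
    template a = Vec.map proj₁ (proj₂ (σ a))

    inside-template : ∀ {t a} → Inside t a → a ≢ α → a ≢ β → template a ≡ t
    inside-template {t} {a} ins a≢α a≢β =
      trans (cong (Vec.map proj₁) (inside-codes ins)) (codes-template a≢α a≢β t (at t a))

    -- A colouring of the copy t that agrees with the others on the shared parts α and β.
    Fits : Fin k → Fin k → Template E D → Set
    Fits i j t = Σ[ ψ ∈ (V C → Fin k) ]
      (∀ {a b} → Inside t a → Inside t b → P.Adj (at t a) (at t b) → ψ a ≢ ψ b) ×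
      (Inside t α → ψ α ≡ i) × (Inside t β → ψ β ≡ j)

    own : Template E D → V C → Fin k
    own t = proj₁ (transversal (at t))

    own-proper : ∀ {t a b} → Inside t a → Inside t b → P.Adj (at t a) (at t b) → own t a ≢ own t b
    own-proper {t} insa insb = proj₂ (transversal (at t)) (inside-π insa) (inside-π insb)

    recoloured : ∀ {i j} t (f : Fin k → Fin k) → Injective _≡_ _≡_ f →
                 (Inside t α → f (own t α) ≡ i) → (Inside t β → f (own t β) ≡ j) → Fits i j t
    recoloured t f f-inj fα fβ =
      f ∘ own t , (λ insa insb ab eq → own-proper insa insb ab (f-inj eq)) , fα , fβ

    -- A copy meeting at most one shared vertex is adjusted by one transposition of colours, which
    -- leaves the copies meeting both.
    fits : ∀ i j → (∀ t → Inside t α → Inside t β → Fits i j t) → ∀ t → Fits i j t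
    fits i j both t with inside? t α | inside? t β
    ... | yes insα | yes insβ = both t insα insβ
    ... | yes _    | no ¬insβ = recoloured t (transpose (own t α) i) (transpose-injective _ _)
                                  (λ _ → transpose-left (own t α) i) (λ insβ → contradiction insβ ¬insβ)
    ... | no ¬insα | yes _    = recoloured t (transpose (own t β) j) (transpose-injective _ _)
                                  (λ insα → contradiction insα ¬insα) (λ _ → transpose-left (own t β) j)
    ... | no ¬insα | no ¬insβ = recoloured t id id
                                  (λ insα → contradiction insα ¬insα) (λ insβ → contradiction insβ ¬insβ)

    Colours : Set
    Colours = Σ[ φ ∈ (V C → Fin k) ]
      (∀ {a b} → proj₁ (σ a) ≡ a → proj₁ (σ b) ≡ b → Adj′ (σ a) (σ b) → φ a ≢ φ b)

    -- Each edge lies in a single copy `t`, and the glued colouring agrees with that of `t` at both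
    -- ends.
    glue : ∀ i j → (∀ t → Fits i j t) → Colours
    glue i j fit = φ , λ πa πb (t , ∗∈t , p , q , σa≡ , σb≡ , pq) →
      let ap = trans (cong (loc t) σa≡) (loc-ι ∗∈t p)
          bq = trans (cong (loc t) σb≡) (loc-ι ∗∈t q)
          insa = ∗∈t , trans σa≡ (cong (ι t) (sym ap)) , πa
          insb = ∗∈t , trans σb≡ (cong (ι t) (sym bq)) , πb
      in subst₂ _≢_ (sym (φ-inside insa)) (sym (φ-inside insb))
           (proj₁ (proj₂ (fit t)) insa insb (subst₂ P.Adj (sym ap) (sym bq) pq))
      where
      φ : V C → Fin k
      φ a with a ≟ᶜ α | a ≟ᶜ β
      ... | yes _ | _     = i
      ... | no _  | yes _ = j
      ... | no _  | no _  = proj₁ (fit (template a)) a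
      φ-inside : ∀ {t a} → Inside t a → φ a ≡ proj₁ (fit t) a
      φ-inside {t} {a} ins with a ≟ᶜ α | a ≟ᶜ β
      ... | yes refl | _        = sym (proj₁ (proj₂ (proj₂ (fit t))) ins)
      ... | no _     | yes refl = sym (proj₂ (proj₂ (proj₂ (fit t))) ins)
      ... | no a≢α   | no a≢β   = cong (λ s → proj₁ (fit s) a) (inside-template ins a≢α a≢β)

    -- A copy t₀ meets both shared vertices. Copies meeting them in the same places as
    -- t₀ are merged into a single transversal; any other has an edge between them.
    anchored : ∀ t₀ → Inside t₀ α → Inside t₀ β → Colours
    anchored t₀ ins₀α ins₀β = glue (φ* α) (φ* β) (fits (φ* α) (φ* β) both)
      where
      choice : V C → Template E D
      choice a with a ≟ᶜ α | a ≟ᶜ β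
      ... | yes _ | _     = t₀
      ... | no _  | yes _ = t₀
      ... | no _  | no _  = template a
      -- The shared vertices are decoded in `t₀`, every other vertex in its own copy.
      merged : V C → P.V
      merged a = at (choice a) a
      φ* : V C → Fin k
      φ* = proj₁ (transversal merged)
      φ*-proper : ∀ {t} → at t α ≡ at t₀ α → at t β ≡ at t₀ β → ∀ {a b} → Inside t a → Inside t b →
                  P.Adj (at t a) (at t b) → φ* a ≢ φ* b
      φ*-proper {t} α≡ β≡ {a} {b} insa insb ab = proj₂ (transversal merged)
        (trans (cong π (merged≡ insa)) (inside-π insa)) (trans (cong π (merged≡ insb)) (inside-π insb))
        (subst₂ P.Adj (sym (merged≡ insa)) (sym (merged≡ insb)) ab)
        where
        merged≡ : ∀ {a} → Inside t a → merged a ≡ at t a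
        merged≡ {a} ins with a ≟ᶜ α | a ≟ᶜ β
        ... | yes refl | _        = sym α≡
        ... | no _     | yes refl = sym β≡
        ... | no a≢α   | no a≢β   = cong (λ s → at s a) (inside-template ins a≢α a≢β)
      both : ∀ t → Inside t α → Inside t β → Fits (φ* α) (φ* β) t
      both t insα insβ with at t α ≟ᵖ at t₀ α ×-dec at t β ≟ᵖ at t₀ β
      ... | yes (α≡ , β≡) = φ* , φ*-proper α≡ β≡ , (λ _ → refl) , (λ _ → refl)
      -- Used in both directions: each of the two copies gets an edge between its vertices in the
      -- shared parts.
      ... | no ¬same with sharedPair (proj₁ insα) sharedα sharedβ | sharedPair (proj₁ ins₀α) (sym sharedα) (sym sharedβ)
        where
        sharedα : codes α t (at t α) ≡ codes α t₀ (at t₀ α)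
        sharedα = trans (sym (inside-codes insα)) (inside-codes ins₀α)
        sharedβ : codes β t (at t β) ≡ codes β t₀ (at t₀ β)
        sharedβ = trans (sym (inside-codes insβ)) (inside-codes ins₀β)
      ... | inj₁ same | _ = contradiction same ¬same
      ... | inj₂ _ | inj₁ (α≡ , β≡) = contradiction (sym α≡ , sym β≡) ¬same
      -- The two edges make both pairs of colours distinct, so a permutation carries one to the
      -- other.
      ... | inj₂ xy | inj₂ x₀y₀ with recolourTwo (own-proper insα insβ xy)
                                            (φ*-proper refl refl ins₀α ins₀β x₀y₀)
      ... | f , f-inj , fα , fβ = recoloured t f f-inj (λ _ → fα) (λ _ → fβ)

    colours : Colours
    colours = branch (Finite.search template-finite (λ t → inside? t α ×-dec inside? t β))
      where
      -- Any colours serve in the case without a copy meeting both; a colouring of an arbitrary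
      -- choice supplies them even though `k` is not known to be positive.
      default : V C → Fin k
      default = proj₁ (transversal (λ a → proj₂ (Vec.head (proj₂ (σ a)))))
      branch : Dec (∃[ t ] Inside t α × Inside t β) → Colours
      branch (yes (t₀ , ins₀α , ins₀β)) = anchored t₀ ins₀α ins₀β
      branch (no ¬both) = glue (default α) (default β)
        (fits (default α) (default β) λ t insα insβ → contradiction (t , insα , insβ) ¬both)

-- Homogenising all pairs of parts.

record Homogenised (C : FiniteGraph) (S : System C) (pairs : List (V C × V C)) : Set₁ where
  private module S = System S
  field
    system : System C
  open System system using (graph; π)
  field
    homogeneous : ((c , _) : SymColouring (V graph)) → Σ[ f ∈ Embedding S.graph graph ]
      (∀ v → π (embed f v) ≡ S.π v) ×
      (∀ {α β} → (α , β) ∈ˡ pairs → ∃[ a ] (∀ {x y} → S.π x ≡ α → S.π y ≡ β →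
        FiniteGraph.Adj S.graph x y → c (embed f x) (embed f y) ≡ a))

-- The head pair is amalgamated last. In a copy of the inner system homogeneous for it, the
-- pulled-back colouring is treated by induction, and passing to a smaller copy keeps homogeneity.
homogenise : ∀ k C S → Transversal k C S → ∀ pairs →
             Σ[ H ∈ Homogenised C S pairs ] Transversal k C (Homogenised.system H)
homogenise k C S transversal [] = record
  { system      = S
  ; homogeneous = λ _ → record { embed = id ; injective = id ; edge = id } , (λ _ → refl) , λ ()
  } , transversal
homogenise k C S transversal ((α , β) ∷ pairs) with homogenise k C S transversal pairs
... | H , transversalH = record { system = amalgam ; homogeneous = go } , colours k transversalH
  where
  module S = System S
  open Homogenised H using (system; homogeneous)
  open System system using (graph; π)
  open Amalgam C system α β
  go : ((c , _) : SymColouring V′) → Σ[ f ∈ Embedding S.graph (System.graph amalgam) ]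
    (∀ v → proj₁ (embed f v) ≡ S.π v) ×
    (∀ {α′ β′} → (α′ , β′) ∈ˡ (α , β) ∷ pairs → ∃[ a ] (∀ {x y} → S.π x ≡ α′ → S.π y ≡ β′ →
      FiniteGraph.Adj S.graph x y → c (embed f x) (embed f y) ≡ a))
  go (c , c-sym) with homogeneousCopy c
  ... | t , ∗∈t , a , mono with homogeneous ((λ u v → c (ι t u) (ι t v)) , λ u v → c-sym _ _)
  ... | f , f-π , f-mono = record
      { embed     = ι t ∘ embed f
      ; injective = Embedding.injective f ∘ Embedding.injective (copy ∗∈t)
      ; edge      = Embedding.edge (copy ∗∈t) ∘ Embedding.edge f
      } , f-π , λ where
        (hereˡ refl)  → a , λ πx πy xy → mono (trans (f-π _) πx) (trans (f-π _) πy) (Embedding.edge f xy)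
        (thereˡ pair) → f-mono pair

-- The initial system, and monochromatic copies from homogeneity.

module _ (G : Graph) (C : FiniteGraph) where

  private
    module G = Graph G
    module C = FiniteGraph C
    maps-finite : Finite (Vec C.V G.order)
    maps-finite = Vec-finite C.finite G.order

  -- One copy of G for each map from the vertices of G to those of C, keeping only
  -- the edges that the map preserves.
  copies : System C
  copies = record
    { graph = record
      { V          = Vec C.V G.order × Vertex G
      ; finite     = ×-finite maps-finite (Fin-finite G.order)
      ; Adj        = λ (f , u) (g , v) → f ≡ g × G.Adj u v × C.Adj (Vec.lookup f u) (Vec.lookup g v)
      ; adj?       = λ (f , u) (g , v) → Finite._≟_ maps-finite f g ×-dec G.adj? u v ×-dec
                       C.adj? (Vec.lookup f u) (Vec.lookup g v)
      ; adj-sym    = λ (f≡g , uv , fu-gv) → sym f≡g , G.adj-sym uv , C.adj-sym fu-gv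
      ; adj-irrefl = λ (_ , _ , fu-fu) → C.adj-irrefl fu-fu
      }
    ; π   = λ (f , u) → Vec.lookup f u
    ; hom = λ (_ , _ , fu-gv) → fu-gv
    }

  -- Every edge projects to an edge of `G`, so a colouring of `G` pulls back.
  copies-transversal : ∀ {k} → Colourable G k → Transversal k C copies
  copies-transversal (φ , proper) σ = φ ∘ proj₂ ∘ σ , λ _ _ (_ , uv , _) → proper _ _ uv

  allPairs : List (C.V × C.V)
  allPairs = elements (×-finite C.finite C.finite)

  -- The colours found for (α , β) and (β , α) may differ when no edge joins these parts.
  meet : Fin 2 → Fin 2 → Fin 2
  meet zero    _ = zero
  meet (suc _) j = j

  meet-comm : ∀ i j → meet i j ≡ meet j i
  meet-comm zero       zero       = refl
  meet-comm zero       (suc zero) = refl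
  meet-comm (suc zero) zero       = refl
  meet-comm (suc zero) (suc zero) = refl

  meet-idem : ∀ i → meet i i ≡ i
  meet-idem zero    = refl
  meet-idem (suc _) = refl

  -- The colours between parts of the homogeneous copy define a colouring of `C`. A monochromatic
  -- `h` for it selects the copy of `G` indexed by `h`, which keeps all its edges.
  homogenised-arrows : Arrows C (finiteGraph G) → (H : Homogenised C copies allPairs) →
                       Arrows (System.graph (Homogenised.system H)) (finiteGraph G)
  homogenised-arrows arrows H (c , c-sym) with Homogenised.homogeneous H (c , c-sym)
  ... | f , _ , f-mono with arrows ((λ α β → meet (colour α β) (colour β α)) ,
                                    λ α β → meet-comm (colour α β) (colour β α))
    where
    colour : C.V → C.V → Fin 2
    colour α β = proj₁ (f-mono (∈-elements (×-finite C.finite C.finite) (α , β)))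
  ... | h , a , h-mono = record
      { embed     = λ u → embed f (map-h , u)
      ; injective = cong proj₂ ∘ Embedding.injective f
      ; edge      = Embedding.edge f ∘ adjacent
      -- On an edge both orientations have the same colour under `c`, so `meet` returns it.
      } , a , λ {u} {v} uv → trans (sym (trans
        (cong₂ meet (sym (mono uv)) (trans (sym (mono (G.adj-sym uv))) (c-sym _ _))) (meet-idem _))) (h-mono uv)
    where
    map-h : Vec C.V G.order
    map-h = Vec.tabulate (embed h)
    lookup-h : ∀ u → Vec.lookup map-h u ≡ embed h u
    lookup-h = Vec.lookup∘tabulate (embed h)
    adjacent : ∀ {u v} → G.Adj u v → map-h ≡ map-h × G.Adj u v × C.Adj (Vec.lookup map-h u) (Vec.lookup map-h v)
    adjacent uv = refl , uv , subst₂ C.Adj (sym (lookup-h _)) (sym (lookup-h _)) (Embedding.edge h uv)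
    mono : ∀ {u v} → G.Adj u v → c (embed f (map-h , u)) (embed f (map-h , v)) ≡
           proj₁ (f-mono (∈-elements (×-finite C.finite C.finite) (embed h u , embed h v)))
    mono {u} {v} uv = proj₂ (f-mono (∈-elements (×-finite C.finite C.finite) (embed h u , embed h v)))
      (lookup-h u) (lookup-h v) (adjacent uv)

-- A set of s + 1 vertices of P either is transversal or projects to at most s vertices of C.
transversal⇒local : ∀ {k s C} (P : System C) → Transversal k C P → Local k s C → Local k (suc s) (System.graph P)
transversal⇒local {k} {s} {C} P transversal local g =
  branch (any? λ i → any? λ j → ¬? (i Fin.≟ j) ×-dec π (g i) ≟ᶜ π (g j))
  where
  module C = FiniteGraph C
  open System P using (π; hom)
  open Finite C.finite using () renaming (_≟_ to _≟ᶜ_)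
  branch : Dec (∃[ i ] ∃[ j ] i ≢ j × π (g i) ≡ π (g j)) →
    Σ[ φ ∈ (Fin (suc s) → Fin k) ] (∀ i j → FiniteGraph.Adj (System.graph P) (g i) (g j) → φ i ≢ φ j)
  -- Index `j` is deleted and later receives the colour of `i`, which lies in the same part.
  branch (yes (i , j , i≢j , πi≡πj)) with local (π ∘ g ∘ punchIn j)
  ... | φ , proper = φ ∘ retract , λ l m lm →
      proper (retract l) (retract m) (subst₂ C.Adj (sym (π-retract l)) (sym (π-retract m)) (hom lm))
    where
    retract : Fin (suc s) → Fin s
    retract l with j Fin.≟ l
    ... | yes _  = punchOut (i≢j ∘ sym)
    ... | no j≢l = punchOut j≢l
    π-retract : ∀ l → π (g (punchIn j (retract l))) ≡ π (g l)
    π-retract l with j Fin.≟ l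
    ... | yes refl = trans (cong (π ∘ g) (punchIn-punchOut (i≢j ∘ sym))) πi≡πj
    ... | no j≢l   = cong (π ∘ g) (punchIn-punchOut j≢l)
  branch (no distinct) = φ ∘ π ∘ g , λ l m lm → proper
      (cong π (σ-π l)) (cong π (σ-π m)) (subst₂ (FiniteGraph.Adj (System.graph P)) (sym (σ-π l)) (sym (σ-π m)) lm)
    where
    pick : ∀ {c} → Dec (∃[ l ] π (g l) ≡ c) → V (System.graph P)
    pick (yes (l , _)) = g l
    -- This default lies outside part `c`, so `Transversal` ignores it.
    pick (no _)        = g zero
    σ : V C → V (System.graph P)
    σ c = pick (any? λ l → π (g l) ≟ᶜ c)
    pick-π : ∀ l (found : Dec (∃[ m ] π (g m) ≡ π (g l))) → pick found ≡ g l
    pick-π l (no none) = contradiction (l , refl) none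
    pick-π l (yes (m , πm≡πl)) with m Fin.≟ l
    ... | yes refl = refl
    ... | no m≢l   = contradiction (m , l , m≢l , πm≡πl) distinct
    σ-π : ∀ l → σ (π (g l)) ≡ g l
    σ-π l = pick-π l (any? λ m → π (g m) ≟ᶜ π (g l))
    φ : V C → Fin k
    φ = proj₁ (transversal σ)
    proper : ∀ {a b} → π (σ a) ≡ a → π (σ b) ≡ b → FiniteGraph.Adj (System.graph P) (σ a) (σ b) → φ a ≢ φ b
    proper = proj₂ (transversal σ)

-- Induction on the size of the locally colourable sets.

locallyColourable-arrows : ∀ G {k} → Colourable G k → ∀ s →
                           Σ[ C ∈ FiniteGraph ] Arrows C (finiteGraph G) × Local k s C
locallyColourable-arrows G col zero with complete-arrows G
... | N , arrows = complete N , arrows , λ _ → (λ ()) , λ ()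
locallyColourable-arrows G {k} col (suc s) with locallyColourable-arrows G col s
... | C , arrows , local with homogenise k C (copies G C) (copies-transversal G C col) (allPairs G C)
... | H , transversal = System.graph (Homogenised.system H) , homogenised-arrows G C arrows H ,
                        transversal⇒local (Homogenised.system H) transversal local

-- Transfer to graphs on `Fin n`.

toGraph : FiniteGraph → Graph
toGraph C = record
  { order      = size C.finite
  ; Adj        = λ i j → C.Adj (fromFin C.finite i) (fromFin C.finite j)
  ; adj?       = λ i j → C.adj? (fromFin C.finite i) (fromFin C.finite j)
  ; adj-sym    = C.adj-sym
  ; adj-irrefl = λ { refl → C.adj-irrefl }
  }
  where module C = FiniteGraph C

arrows⇒⟶ : ∀ {C G} → Arrows C (finiteGraph G) → toGraph C ⟶ G
arrows⇒⟶ {C} {G} arrows ec = copyOf (arrows (colour , colour-sym))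
  where
  module C = FiniteGraph C
  module F = Graph (toGraph C)
  open EdgeColouring ec using (col; col-sym)
  to : C.V → Vertex (toGraph C)
  to = toFin C.finite
  colourOf : ∀ {i j} → Dec (F.Adj i j) → Fin 2
  colourOf (yes e) = col e
  -- An arbitrary colour extends the edge colouring to all pairs.
  colourOf (no _)  = zero
  colour : C.V → C.V → Fin 2
  colour u v = colourOf (F.adj? (to u) (to v))
  colourOf-sym : ∀ {i j} (d : Dec (F.Adj i j)) (d′ : Dec (F.Adj j i)) → colourOf d ≡ colourOf d′
  colourOf-sym (yes e) (yes e′) = col-sym e e′
  colourOf-sym (yes e) (no ¬e′) = contradiction (C.adj-sym e) ¬e′
  colourOf-sym (no ¬e) (yes e′) = contradiction (C.adj-sym e′) ¬e
  colourOf-sym (no _)  (no _)   = refl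
  colour-sym : ∀ u v → colour u v ≡ colour v u
  colour-sym u v = colourOf-sym (F.adj? (to u) (to v)) (F.adj? (to v) (to u))
  colourOf-edge : ∀ {i j} (e : F.Adj i j) (d : Dec (F.Adj i j)) → col e ≡ colourOf d
  -- Passing through the reversed edge shows that the colour is independent of the adjacency proof.
  colourOf-edge e (yes e′) = trans (col-sym e (C.adj-sym e)) (col-sym (C.adj-sym e) e′)
  colourOf-edge e (no ¬e)  = contradiction e ¬e
  copyOf : (Σ[ f ∈ Embedding (finiteGraph G) C ] ∃[ a ]
             (∀ {u v} → Graph.Adj G u v → colour (embed f u) (embed f v) ≡ a)) →
           Σ[ f ∈ Copy G (toGraph C) ] IsMonochromatic ec f
  copyOf (f , a , mono) = record
    { embed     = to ∘ embed f
    ; injective = λ {u} {v} eq → Embedding.injective f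
        (trans (sym (from-to C.finite (embed f u)))
               (trans (cong (fromFin C.finite) eq) (from-to C.finite (embed f v))))
    ; edge      = λ uv → subst₂ C.Adj (sym (from-to C.finite _)) (sym (from-to C.finite _)) (Embedding.edge f uv)
    } , a , λ uv → trans (colourOf-edge _ (F.adj? _ _)) (mono uv)

-- A copy of `H`, of whatever colour, would pull the local colouring back to a proper colouring of
-- `H` with too few colours; the constant edge colouring therefore serves.
local⇒↛ : ∀ {k C} (H : Graph) → Local k (Graph.order H) C → k < χ H → toGraph C ↛ H
local⇒↛ {k} {C} H local k<χH F⟶H with F⟶H (record { col = λ _ → zero ; col-sym = λ _ _ → refl })
... | f , _ with local (fromFin (FiniteGraph.finite C) ∘ Copy.embed f)
... | φ , proper = ℕ.<⇒≱ k<χH (proj₂ (proj₂ (chromaticNumber H)) k (φ , λ u v uv → proper u v (Copy.edge f uv)))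

theorem1 : (G H : Graph) → χ G < χ H → ∃[ F ] (F ⟶ G × F ↛ H)
theorem1 G H χG<χH with locallyColourable-arrows G (proj₁ (proj₂ (chromaticNumber G))) (Graph.order H)
... | C , arrows , local = toGraph C , arrows⇒⟶ arrows , local⇒↛ {C = C} H local χG<χH
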